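{- There exists a sorting network on $17$ channels with $10$ layers; that is, $t_{17}\le 10$, where $t_n$ denotes the minimum depth of a sorting network on $n$ channels.
   Context: A comparator network on $n$ channels is a finite sequence $C=L_1,\ldots,L_d$ of layers, where each layer is a non-empty set of pairs (comparators) $(i,j)$ with $1\le i<j\le n$, and any two distinct comparators in the same layer are disjoint as sets of channels. Its depth (number of layers) is $d$. The network acts on a sequence $(x_1,\ldots,x_n)$ of elements of a totally ordered set by applying the layers in order: applying a layer interchanges the values on channels $i$ and $j$ for every comparator $(i,j)$ of the layer such that the current value on channel $i$ is larger than the one on channel $j$. The network is a sorting network if its output is sorted in non-decreasing order ($x_1\le\cdots\le x_n$) for every input; by the zero-one principle, it is equivalent to require this for all inputs in $\{0,1\}^n$. -}

module Defs where

open import Data.Bool.Base using (if_then_else_)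
open import Data.Fin.Base using (Fin; _<_)
open import Data.Fin.Permutation.Components using (transpose)
open import Data.List.Base using (List; []; foldl; length)
open import Data.List.Relation.Unary.AllPairs using (AllPairs)
import Data.List.Relation.Unary.Sorted.TotalOrder as SortedTO
open import Data.Nat.Base using (ℕ; _≤_)
open import Data.Product.Base using (∃-syntax; _×_)
open import Data.Vec.Functional using (Vector; toList)
open import Function.Base using (_∘_)
open import Level using (Level; _⊔_; suc)
open import Relation.Binary.Bundles using (DecTotalOrder)
open import Relation.Binary.PropositionalEquality.Core using (_≡_; _≢_)
open import Relation.Nullary.Decidable.Core using (does)

record Comparator (n : ℕ) : Set where
  constructor comparator
  field
    lo hi : Fin n
    lo<hi : lo < hi

open Comparator public

Disjoint : ∀ {n} → Comparator n → Comparator n → Set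
Disjoint a b = lo a ≢ lo b × lo a ≢ hi b × hi a ≢ lo b × hi a ≢ hi b

-- The set of comparators is given by a listing of it; disjointness of
-- the entries at distinct positions also excludes repetitions.
record Layer (n : ℕ) : Set where
  constructor layer
  field
    comparators : List (Comparator n)
    nonEmpty    : comparators ≢ []
    disjoint    : AllPairs Disjoint comparators

open Layer public

Network : ℕ → Set
Network n = List (Layer n)

depth : ∀ {n} → Network n → ℕ
depth = length

-- Comparing values requires the order to be decidable; classically every
-- total order is.
module _ {c ℓ₁ ℓ₂} (O : DecTotalOrder c ℓ₁ ℓ₂) where

  open DecTotalOrder O using (Carrier; _≤?_; totalOrder)

  applyComparator : ∀ {n} → Vector Carrier n → Comparator n → Vector Carrier n
  applyComparator x (comparator i j _) =
    if does (x i ≤? x j) then x else x ∘ transpose i j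

  -- The comparators of a layer act on disjoint sets of channels, so
  -- applying them one after another is the same as applying them
  -- simultaneously, in whatever order they are listed.
  applyLayer : ∀ {n} → Vector Carrier n → Layer n → Vector Carrier n
  applyLayer x L = foldl applyComparator x (comparators L)

  applyNetwork : ∀ {n} → Network n → Vector Carrier n → Vector Carrier n
  applyNetwork C x = foldl applyLayer x C

  Sorts : ∀ {n} → Network n → Set (c ⊔ ℓ₂)
  Sorts C = ∀ x → SortedTO.Sorted totalOrder (toList (applyNetwork C x))

-- The levels bound the size of the totally ordered sets quantified over.
module _ (c ℓ₁ ℓ₂ : Level) where

  IsSortingNetwork : ∀ {n} → Network n → Set (suc (c ⊔ ℓ₁ ⊔ ℓ₂))
  IsSortingNetwork C = (O : DecTotalOrder c ℓ₁ ℓ₂) → Sorts O C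

  HasSortingNetwork : (n d : ℕ) → Set (suc (c ⊔ ℓ₁ ⊔ ℓ₂))
  HasSortingNetwork n d =
    ∃[ C ] depth {n} C ≡ d × IsSortingNetwork C

  -- IsMinDepth n t says that t = tₙ.
  IsMinDepth : (n t : ℕ) → Set (suc (c ⊔ ℓ₁ ⊔ ℓ₂))
  IsMinDepth n t =
    HasSortingNetwork n t × (∀ d → HasSortingNetwork n d → t ≤ d)

{-# OPTIONS --safe #-}

-- The network is a Green filter of three layers on channels 1–16, followed by
-- seven layers found by the SAT search of Ehlers and Müller.  By the zero-one
-- principle it is enough to follow, for each threshold a, the bits "a ≤ value".
-- These are executed symbolically with some bits unknown: only a comparator with
-- two unknown inputs needs a case distinction, and its output bits are then 00,
-- 01 or 11.  Only the eight comparators of the first layer meet that case, so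
-- that 3⁸ executions replace the 2¹⁷ inputs.
module Submission where

open import Defs
open import Data.Bool.Base using (Bool; true; false; T; _∧_; _∨_)
open import Data.Bool.Properties using (T-∧; T-≡; ∧-comm; ∧-zeroʳ; ∨-comm; ∨-zeroʳ)
open import Data.Fin using (#_)
open import Data.Fin.Base using (Fin; zero; suc; inject₁)
open import Data.Fin.Permutation.Components using (transpose)
open import Data.Fin.Properties using (_≟_; _<?_; <⇒≢)
open import Data.List.Base using (List; []; _∷_; concatMap; foldl; tabulate)
open import Data.List.Properties using (foldl-++)
open import Data.List.Relation.Unary.AllPairs using (allPairs?)
open import Data.List.Relation.Unary.Linked using (Linked; []; [-]; _∷_)
open import Data.Maybe.Base using (Maybe; just; nothing)
open import Data.Maybe.Relation.Unary.All as Maybe using (just; nothing)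
open import Data.Nat.Base using (ℕ; zero; suc; _≤_)
import Data.Nat.Properties as ℕ
open import Data.Product.Base using (_×_; _,_; proj₁; proj₂; ∃₂)
open import Data.Sum.Base using (inj₁; inj₂)
open import Data.Unit.Base using (tt)
open import Data.Vec.Base using (Vec; []; _∷_; lookup; _[_]≔_; replicate)
open import Data.Vec.Functional using (Vector)
open import Data.Vec.Properties using (lookup∘update; lookup∘update′; lookup-replicate)
open import Function.Base using (_∘_)
open import Function.Bundles using (Equivalence)
open import Level using (Level)
open import Relation.Binary.Bundles using (DecTotalOrder)
open import Relation.Binary.Core using (Rel)
open import Relation.Binary.Definitions using (Decidable)
open import Relation.Binary.PropositionalEquality
  using (_≡_; _≢_; refl; sym; trans; cong; subst; ≢-sym)
open import Relation.Nullary.Negation.Core using (contradiction)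
open import Relation.Nullary.Decidable
  using (yes; no; isYes; True; toWitness; fromWitness; ¬?; _×-dec_; dec-true; dec-false)

private
  variable
    n : ℕ

-- `nothing` is an unknown bit, and `∋` allows it either value. A `Vec Bit? n` thus stands for all
-- 0-1 inputs that agree with its known entries.
Bit? : Set
Bit? = Maybe Bool

infix 4 _∋_ _⊒_

_∋_ : Bit? → Bool → Set
p ∋ b = Maybe.All (_≡ b) p

_⊒_ : Vec Bit? n → Vector Bool n → Set
s ⊒ v = ∀ i → lookup s i ∋ v i

-- The continuation `k` is the rest of the run, so a case distinction becomes a conjunction of runs.
-- One known bit already settles the exchange: a 0 goes to the low channel or a 1 to the high one,
-- and the other bit, even if unknown, takes the place left.
compareBits : Bit? → Bit? → (Bit? → Bit? → Bool) → Bool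
compareBits nothing      nothing      k =
  k (just false) (just false) ∧ k (just false) (just true) ∧ k (just true) (just true)
compareBits (just false) q            k = k (just false) q
compareBits (just true)  q            k = k q (just true)
compareBits p            (just false) k = k (just false) p
compareBits p            (just true)  k = k p (just true)

compareBits-sound : ∀ {p q a b} k → p ∋ a → q ∋ b → T (compareBits p q k) →
                    ∃₂ λ p′ q′ → p′ ∋ a ∧ b × q′ ∋ a ∨ b × T (k p′ q′)
compareBits-sound {a = a} {b} k nothing nothing ok
  with k₀₀ , k₀₁∧k₁₁ ← Equivalence.to (T-∧ {k (just false) (just false)}) ok
  with k₀₁ , k₁₁ ← Equivalence.to (T-∧ {k (just false) (just true)}) k₀₁∧k₁₁
  with a | b
... | false | false = _ , _ , just refl , just refl , k₀₀
... | false | true  = _ , _ , just refl , just refl , k₀₁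
-- Inputs 10 leave the comparator as 01, so they share the branch of 01.
... | true  | false = _ , _ , just refl , just refl , k₀₁
... | true  | true  = _ , _ , just refl , just refl , k₁₁
compareBits-sound {a = false} k (just refl) q∋b ok = _ , _ , just refl , q∋b , ok
compareBits-sound {a = true}  k (just refl) q∋b ok = _ , _ , q∋b , just refl , ok
compareBits-sound {a = a} {false} k nothing (just refl) ok =
  _ , _ , subst (just false ∋_) (sym (∧-zeroʳ a)) (just refl) , nothing , ok
compareBits-sound {a = a} {true}  k nothing (just refl) ok =
  _ , _ , nothing , subst (just true ∋_) (sym (∨-zeroʳ a)) (just refl) , ok

-- True only when the order holds whatever the unknown bits are. A final state 0...0?1...1 with a
-- single unknown bit therefore still passes as ascending.
_≤ᵇ?_ : Bit? → Bit? → Bool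
just false ≤ᵇ? _         = true
_          ≤ᵇ? just true = true
_          ≤ᵇ? _         = false

≤ᵇ?-sound : ∀ {p q a b} → T (p ≤ᵇ? q) → p ∋ a → q ∋ b → T a → T b
≤ᵇ?-sound {just false}            _ (just refl) _           ()
≤ᵇ?-sound {just true} {just true} _ _           (just refl) _ = tt
≤ᵇ?-sound {nothing}   {just true} _ _           (just refl) _ = tt

ascending : Vec Bit? n → Bool
ascending []          = true
ascending (_ ∷ [])    = true
ascending (p ∷ q ∷ s) = (p ≤ᵇ? q) ∧ ascending (q ∷ s)

ascending-sound : ∀ (s : Vec Bit? (suc n)) {v} → T (ascending s) → s ⊒ v →
                  ∀ i → T (v (inject₁ i)) → T (v (suc i))
ascending-sound (p ∷ q ∷ s) asc s⊒v zero    =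
  ≤ᵇ?-sound (proj₁ (Equivalence.to T-∧ asc)) (s⊒v zero) (s⊒v (suc zero))
ascending-sound (p ∷ q ∷ s) asc s⊒v (suc i) =
  ascending-sound (q ∷ s) (proj₂ (Equivalence.to (T-∧ {p ≤ᵇ? q}) asc)) (s⊒v ∘ suc) i

sortsBits : List (Comparator n) → Vec Bit? n → Bool
sortsBits []                     s = ascending s
sortsBits (comparator i j _ ∷ C) s =
  compareBits (lookup s i) (lookup s j) λ p q → sortsBits C ((s [ i ]≔ p) [ j ]≔ q)

transpose-fst : ∀ (i j : Fin n) → transpose i j i ≡ j
transpose-fst i j rewrite dec-true (i ≟ i) refl = refl

transpose-snd : ∀ {i j : Fin n} → i ≢ j → transpose i j j ≡ i
transpose-snd {i = i} {j} i≢j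
  rewrite dec-false (j ≟ i) (≢-sym i≢j) | dec-true (j ≟ j) refl = refl

transpose-other : ∀ {i j k : Fin n} → k ≢ i → k ≢ j → transpose i j k ≡ k
transpose-other {i = i} {j} {k} k≢i k≢j
  rewrite dec-false (k ≟ i) k≢i | dec-false (k ≟ j) k≢j = refl

linked-tabulate : ∀ {a ℓ} {A : Set a} {R : Rel A ℓ} (f : Fin (suc n) → A) →
                  (∀ i → R (f (inject₁ i)) (f (suc i))) → Linked R (tabulate f)
linked-tabulate {n = zero}  f Rf = [-]
linked-tabulate {n = suc n} f Rf = Rf zero ∷ linked-tabulate (f ∘ suc) (Rf ∘ suc)

module ZeroOne {c ℓ₁ ℓ₂} (O : DecTotalOrder c ℓ₁ ℓ₂) where

  open DecTotalOrder O using (Carrier; _≤?_; total)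
    renaming (_≤_ to _≼_; trans to ≼-trans; refl to ≼-refl)

  above : Carrier → Carrier → Bool
  above a x = isYes (a ≤? x)

  -- Thresholding is monotone, so it turns minima into conjunctions and, in `above-∨`, maxima into
  -- disjunctions. Hence it commutes with comparators, the core of the zero-one principle.
  above-∧ : ∀ a {x y} → x ≼ y → above a x ≡ above a x ∧ above a y
  above-∧ a {x} {y} x≼y with a ≤? x | a ≤? y
  ... | no  _   | _       = refl
  ... | yes _   | yes _   = refl
  ... | yes a≼x | no  a⋠y = contradiction (≼-trans a≼x x≼y) a⋠y

  above-∨ : ∀ a {x y} → x ≼ y → above a y ≡ above a x ∨ above a y
  above-∨ a {x} {y} x≼y with a ≤? x | a ≤? y
  ... | no  _   | _       = refl
  ... | yes _   | yes _   = refl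
  ... | yes a≼x | no  a⋠y = contradiction (≼-trans a≼x x≼y) a⋠y

  applyComparator-bits : ∀ a (x : Vector Carrier n) C →
    let y = applyComparator O x C in
    above a (y (lo C)) ≡ above a (x (lo C)) ∧ above a (x (hi C)) ×
    above a (y (hi C)) ≡ above a (x (lo C)) ∨ above a (x (hi C)) ×
    (∀ k → k ≢ lo C → k ≢ hi C → y k ≡ x k)
  applyComparator-bits a x (comparator i j i<j) with x i ≤? x j
  ... | yes xi≼xj = above-∧ a xi≼xj , above-∨ a xi≼xj , λ _ _ _ → refl
  ... | no  xi⋠xj
    -- After the swap the smaller value `x j` sits on channel `i`; commutativity restates the goals
    -- for the ordered pair `x j`, `x i`.
    rewrite transpose-fst i j | transpose-snd (<⇒≢ i<j)
          | ∧-comm (above a (x i)) (above a (x j))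
          | ∨-comm (above a (x i)) (above a (x j)) =
    above-∧ a xj≼xi , above-∨ a xj≼xi , λ k k≢i k≢j → cong x (transpose-other k≢i k≢j)
    where
    xj≼xi : x j ≼ x i
    xj≼xi with total (x i) (x j)
    ... | inj₁ xi≼xj = contradiction xi≼xj xi⋠xj
    ... | inj₂ xj≼xi = xj≼xi

  applyComparator-⊒ : ∀ a (x : Vector Carrier n) C {s p q} → s ⊒ above a ∘ x →
    p ∋ above a (x (lo C)) ∧ above a (x (hi C)) →
    q ∋ above a (x (lo C)) ∨ above a (x (hi C)) →
    (s [ lo C ]≔ p) [ hi C ]≔ q ⊒ above a ∘ applyComparator O x C
  applyComparator-⊒ a x C@(comparator i j i<j) {s} {p} {q} s⊒x p∋∧ q∋∨ k
    with applyComparator-bits a x C | k ≟ i | k ≟ j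
  -- The update at `j` is the outer one, so this case comes first; the others need `k≢j` to look
  -- past it.
  ... | _ , yj , _ | _        | yes refl
    rewrite lookup∘update j (s [ i ]≔ p) q = subst (q ∋_) (sym yj) q∋∨
  ... | yi , _ , _ | yes refl | no k≢j
    rewrite lookup∘update′ k≢j (s [ i ]≔ p) q | lookup∘update i s p = subst (p ∋_) (sym yi) p∋∧
  ... | _ , _ , yk | no k≢i   | no k≢j
    rewrite lookup∘update′ k≢j (s [ i ]≔ p) q | lookup∘update′ k≢i s p =
    subst (λ z → lookup s k ∋ above a z) (sym (yk k k≢i k≢j)) (s⊒x k)

  -- For a fixed threshold, `s ⊒ above a ∘ x` is the invariant: at each case distinction the actual
  -- bits select the branch to follow.
  sortsBits-sound : ∀ a (C : List (Comparator (suc n))) s x →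
    T (sortsBits C s) → s ⊒ above a ∘ x → let y = foldl (applyComparator O) x C in
    ∀ i → T (above a (y (inject₁ i))) → T (above a (y (suc i)))
  sortsBits-sound a []      s x asc s⊒x = ascending-sound s asc s⊒x
  sortsBits-sound a (C ∷ D) s x ok s⊒x
    with _ , _ , p∋∧ , q∋∨ , ok′ ← compareBits-sound _ (s⊒x (lo C)) (s⊒x (hi C)) ok =
    sortsBits-sound a D _ _ ok′ (applyComparator-⊒ a x C {s} s⊒x p∋∧ q∋∨)

  applyNetwork-flatten : ∀ (N : Network n) x →
    applyNetwork O N x ≡ foldl (applyComparator O) x (concatMap comparators N)
  applyNetwork-flatten []      x = refl
  applyNetwork-flatten (L ∷ N) x = trans
    (applyNetwork-flatten N (applyLayer O x L))
    (sym (foldl-++ (applyComparator O) x (comparators L) (concatMap comparators N)))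

  -- Stated for n rather than suc n: at 17 the two sides of the hypothesis must
  -- match syntactically, lest Agda evaluate the 3⁸ executions again.
  zero-one : ∀ (N : Network n) →
             sortsBits (concatMap comparators N) (replicate _ nothing) ≡ true → Sorts O N
  zero-one {zero}  N ok x = []
  zero-one {suc n} N ok x rewrite applyNetwork-flatten N x = linked-tabulate y λ i →
    -- Each adjacent pair gets its own threshold, the output value on the left: its bit is 1 by
    -- reflexivity, so the right bit is 1, which is the desired inequality. The all-unknown start
    -- admits every input.
    toWitness (sortsBits-sound (y (inject₁ i)) C (replicate _ nothing) x (Equivalence.from T-≡ ok)
      (λ j → subst (_∋ above _ (x j)) (sym (lookup-replicate j nothing)) nothing) i
      (fromWitness ≼-refl))
    where
    C = concatMap comparators N
    y = foldl (applyComparator O) x C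

disjoint? : Decidable (Disjoint {n})
disjoint? a b =
  ¬? (lo a ≟ lo b) ×-dec ¬? (lo a ≟ hi b) ×-dec ¬? (hi a ≟ lo b) ×-dec ¬? (hi a ≟ hi b)

infix 6 _⇄_

_⇄_ : ∀ i j {i<n : True (i ℕ.<? n)} {j<n : True (j ℕ.<? n)}
      {i<j : True (#_ i {n} {i<n} <? #_ j {n} {j<n})} → Comparator n
_⇄_ i j {i<n} {j<n} {i<j} = comparator (#_ i {m<n = i<n}) (#_ j {m<n = j<n}) (toWitness i<j)

parallel : (C : Comparator n) (D : List (Comparator n)) →
           {True (allPairs? disjoint? (C ∷ D))} → Layer n
parallel C D {disj} = layer (C ∷ D) (λ ()) (toWitness disj)

network : Network 17
network =
  -- Number channels 1-16 from zero: the first three layers join those differing in just the binary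
  -- digit of weight 1, 2 and 4 respectively.
  parallel (1 ⇄ 2) (3 ⇄ 4 ∷ 5 ⇄ 6 ∷ 7 ⇄ 8 ∷ 9 ⇄ 10 ∷ 11 ⇄ 12 ∷ 13 ⇄ 14 ∷ 15 ⇄ 16 ∷ [])
  ∷ parallel (1 ⇄ 3) (2 ⇄ 4 ∷ 5 ⇄ 7 ∷ 6 ⇄ 8 ∷ 9 ⇄ 11 ∷ 10 ⇄ 12 ∷ 13 ⇄ 15 ∷ 14 ⇄ 16 ∷ [])
  ∷ parallel (1 ⇄ 5) (2 ⇄ 6 ∷ 3 ⇄ 7 ∷ 4 ⇄ 8 ∷ 9 ⇄ 13 ∷ 10 ⇄ 14 ∷ 11 ⇄ 15 ∷ 12 ⇄ 16 ∷ [])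
  -- Channel 0 first takes part here. Its bit is the only one still unknown, so no comparator from
  -- here on meets two unknown bits.
  ∷ parallel (0 ⇄ 3) (1 ⇄ 13 ∷ 2 ⇄ 10 ∷ 4 ⇄ 7 ∷ 5 ⇄ 11 ∷ 6 ⇄ 12 ∷ 8 ⇄ 9 ∷ 14 ⇄ 15 ∷ [])
  ∷ parallel (0 ⇄ 13) (1 ⇄ 8 ∷ 2 ⇄ 5 ∷ 3 ⇄ 6 ∷ 4 ⇄ 14 ∷ 7 ⇄ 15 ∷ 9 ⇄ 16 ∷ 10 ⇄ 11 ∷ [])
  ∷ parallel (0 ⇄ 1) (2 ⇄ 8 ∷ 3 ⇄ 4 ∷ 5 ⇄ 10 ∷ 6 ⇄ 13 ∷ 7 ⇄ 11 ∷ 12 ⇄ 14 ∷ [])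
  ∷ parallel (1 ⇄ 5) (3 ⇄ 8 ∷ 4 ⇄ 10 ∷ 6 ⇄ 7 ∷ 9 ⇄ 12 ∷ 11 ⇄ 13 ∷ [])
  ∷ parallel (1 ⇄ 2) (4 ⇄ 6 ∷ 5 ⇄ 8 ∷ 7 ⇄ 10 ∷ 9 ⇄ 11 ∷ 12 ⇄ 14 ∷ 13 ⇄ 15 ∷ [])
  ∷ parallel (2 ⇄ 3) (4 ⇄ 5 ∷ 6 ⇄ 8 ∷ 7 ⇄ 9 ∷ 10 ⇄ 11 ∷ 12 ⇄ 13 ∷ 14 ⇄ 15 ∷ [])
  ∷ parallel (3 ⇄ 4) (5 ⇄ 6 ∷ 7 ⇄ 8 ∷ 9 ⇄ 10 ∷ 11 ⇄ 12 ∷ 13 ⇄ 14 ∷ 15 ⇄ 16 ∷ [])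
  ∷ []

sortsBits-network : sortsBits (concatMap comparators network) (replicate 17 nothing) ≡ true
sortsBits-network = refl

mainTheorem1 : (c ℓ₁ ℓ₂ : Level) →
    HasSortingNetwork c ℓ₁ ℓ₂ 17 10 × ((t : ℕ) → IsMinDepth c ℓ₁ ℓ₂ 17 t → t ≤ 10)
mainTheorem1 c ℓ₁ ℓ₂ = has , λ t (_ , minimal) → minimal 10 has
  where
  has : HasSortingNetwork c ℓ₁ ℓ₂ 17 10
  has = network , refl , λ O →
    ZeroOne.zero-one O network sortsBits-network
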